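{- Let $a,b$ be positive integers and let $\{F_n(q)\}_{n\geq 0}$ be the $q$-biperiodic Fibonacci sequence. For every integer $n\geq 0$, $$a\sum_{k=0}^{n}F_{2k+1}(q)\,q^{n^2+n-(k^2+k)}=F_{2n+2}(q).$$
   Context: Fix positive integers $a,b$; $q$ is an indeterminate. The $q$-biperiodic Fibonacci sequence is defined by $F_0(q)=0$, $F_1(q)=1$ and, for $n\geq 2$, $F_n(q)=aF_{n-1}(q)+q^{n-2}F_{n-2}(q)$ if $n$ is even, $F_n(q)=bF_{n-1}(q)+q^{n-2}F_{n-2}(q)$ if $n$ is odd. -}

module Defs where

open import Algebra.Bundles.Raw using (RawSemiring)
import Algebra.Definitions.RawSemiring as RawSemiringDefinitions
open import Data.Integer.Base as ℤ using (ℤ; +_; 0ℤ; 1ℤ)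
open import Data.List.Base using (List; []; _∷_; map)
open import Data.Nat.Base as ℕ using (ℕ; zero; suc; parity)
open import Data.Parity.Base using (Parity; 0ℙ; 1ℙ)
open import Level using (0ℓ)
open import Relation.Binary.PropositionalEquality.Core using (_≡_)

-- Elements of ℤ[q]: c₀ ∷ c₁ ∷ … ∷ cₘ ∷ [] stands for c₀ + c₁ q + … + cₘ qᵐ.
-- Trailing zeros are allowed, so equality of polynomials is _≈_, not _≡_.
Poly : Set
Poly = List ℤ

coeff : Poly → ℕ → ℤ
coeff []      _       = 0ℤ
coeff (c ∷ _) zero    = c
coeff (_ ∷ p) (suc i) = coeff p i

infix 4 _≈_

record _≈_ (p r : Poly) : Set where
  constructor coeffs
  field
    coeff-≡ : ∀ i → coeff p i ≡ coeff r i

open _≈_ public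

infixl 6 _+_
infixl 7 _*_

_+_ : Poly → Poly → Poly
[]      + r       = r
(c ∷ p) + []      = c ∷ p
(c ∷ p) + (d ∷ r) = (c ℤ.+ d) ∷ (p + r)

-- (c + q p) r = c r + q (p r)
_*_ : Poly → Poly → Poly
[]      * r = []
(c ∷ p) * r = map (c ℤ.*_) r + (0ℤ ∷ (p * r))

const : ℕ → Poly
const n = + n ∷ []

q : Poly
q = 0ℤ ∷ 1ℤ ∷ []

ℤ[q] : RawSemiring 0ℓ 0ℓ
ℤ[q] = record
  { Carrier = Poly
  ; _≈_     = _≈_
  ; _+_     = _+_
  ; _*_     = _*_
  ; 0#      = []
  ; 1#      = const 1
  }

open RawSemiringDefinitions ℤ[q] public using (_^_; sum)

byParity : ℕ → ℕ → Parity → ℕ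
byParity a b 0ℙ = a
byParity a b 1ℙ = b

F : (a b : ℕ) → ℕ → Poly
F a b zero          = []
F a b (suc zero)    = const 1
F a b (suc (suc m)) =
  const (byParity a b (parity (suc (suc m)))) * F a b (suc m) + q ^ m * F a b m

-- Σ[k≤ n ] f  is  f 0 + f 1 + … + f n, with both end points included.
Σ[k≤_] : ℕ → (ℕ → Poly) → Poly
Σ[k≤ n ] f = sum {suc n} (λ i → f (toℕ i))
  where open import Data.Fin.Base using (toℕ)

{-# OPTIONS --safe #-}
-- Passing from n to n + 1 multiplies every old summand by q^(2n+2), because
-- (n+1)² + (n+1) = (2n+2) + (n² + n), and adds the summand F_{2n+3}.  Hence the left-hand side
-- satisfies the recurrence F_{2n+4} = a F_{2n+3} + q^(2n+2) F_{2n+2} of the right-hand side.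
module Submission where

open import Data.Nat.Base as ℕ using (ℕ; NonZero; _∸_)
open import Defs

open import Algebra.Bundles using (CommutativeMonoid; CommutativeSemiring)
import Algebra.Properties.CommutativeSemigroup as CommutativeSemigroupProperties
import Algebra.Properties.Semiring.Exp as Exp
import Algebra.Properties.Semiring.Sum as Sum
open import Algebra.Structures.Biased using (isCommutativeMonoidˡ; isCommutativeSemiringˡ)
open import Data.Fin.Base using (toℕ; fromℕ; inject₁)
open import Data.Fin.Properties using (toℕ-inject₁; toℕ-fromℕ; toℕ≤pred[n])
open import Data.Integer.Base as ℤ using (ℤ; 0ℤ; 1ℤ)
import Data.Integer.Properties as ℤ
open import Data.List.Base using ([]; _∷_; map)
open import Data.Nat.Base using (zero; suc)
import Data.Nat.Properties as ℕ
import Data.Nat.Tactic.RingSolver as ℕ-Solver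
import Data.Parity.Properties as ℙ
open import Level using (0ℓ)
open import Relation.Binary.PropositionalEquality
  using (_≡_; refl; sym; trans; cong; cong₂; module ≡-Reasoning)
open import Relation.Binary.Structures using (IsEquivalence)
import Relation.Binary.Reasoning.Setoid as ≈-Reasoning

-- Coefficientwise equality and the additive monoid.

coeff-+ : ∀ p r i → coeff (p + r) i ≡ coeff p i ℤ.+ coeff r i
coeff-+ []      r       i       = sym (ℤ.+-identityˡ _)
coeff-+ (c ∷ p) []      i       = sym (ℤ.+-identityʳ _)
coeff-+ (c ∷ p) (d ∷ r) zero    = refl
coeff-+ (c ∷ p) (d ∷ r) (suc i) = coeff-+ p r i

infixr 8 _·_

-- Names the `map` inside `_*_`, so that `(c ∷ p) * r` is definitionally `c · r + (0ℤ ∷ p * r)`.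
_·_ : ℤ → Poly → Poly
c · p = map (c ℤ.*_) p

coeff-· : ∀ c p i → coeff (c · p) i ≡ c ℤ.* coeff p i
coeff-· c []      i       = sym (ℤ.*-zeroʳ c)
coeff-· c (d ∷ p) zero    = refl
coeff-· c (d ∷ p) (suc i) = coeff-· c p i

≈-isEquivalence : IsEquivalence _≈_
≈-isEquivalence = record
  { refl  = coeffs λ _ → refl
  ; sym   = λ e → coeffs λ i → sym (coeff-≡ e i)
  ; trans = λ e f → coeffs λ i → trans (coeff-≡ e i) (coeff-≡ f i)
  }

∷-cong : ∀ {c d p r} → c ≡ d → p ≈ r → c ∷ p ≈ d ∷ r
∷-cong c≡d p≈r = coeffs λ { zero → c≡d ; (suc i) → coeff-≡ p≈r i }

-- Products can leave trailing zeros, so several laws below hold only up to `_≈_`; this removes the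
-- last such zero.
0∷[]≈[] : 0ℤ ∷ [] ≈ []
0∷[]≈[] = coeffs λ { zero → refl ; (suc _) → refl }

+-cong : ∀ {p p′ r r′} → p ≈ p′ → r ≈ r′ → p + r ≈ p′ + r′
+-cong {p} {p′} {r} {r′} e f = coeffs λ i → begin
  coeff (p + r) i            ≡⟨ coeff-+ p r i ⟩
  coeff p i ℤ.+ coeff r i    ≡⟨ cong₂ ℤ._+_ (coeff-≡ e i) (coeff-≡ f i) ⟩
  coeff p′ i ℤ.+ coeff r′ i  ≡⟨ coeff-+ p′ r′ i ⟨
  coeff (p′ + r′) i          ∎
  where open ≡-Reasoning

-- Propositional equality is available because both bracketings have the length of the longest
-- summand.
+-assoc : ∀ p r s → (p + r) + s ≡ p + (r + s)
+-assoc []      r       s       = refl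
+-assoc (c ∷ p) []      s       = refl
+-assoc (c ∷ p) (d ∷ r) []      = refl
+-assoc (c ∷ p) (d ∷ r) (e ∷ s) = cong₂ _∷_ (ℤ.+-assoc c d e) (+-assoc p r s)

+-comm : ∀ p r → p + r ≡ r + p
+-comm []      []      = refl
+-comm []      (d ∷ r) = refl
+-comm (c ∷ p) []      = refl
+-comm (c ∷ p) (d ∷ r) = cong₂ _∷_ (ℤ.+-comm c d) (+-comm p r)

+-commutativeMonoid : CommutativeMonoid 0ℓ 0ℓ
+-commutativeMonoid = record
  { _∙_ = _+_
  ; ε   = []
  ; isCommutativeMonoid = isCommutativeMonoidˡ record
    { isSemigroup = record
      { isMagma = record { isEquivalence = ≈-isEquivalence ; ∙-cong = +-cong }
      ; assoc   = λ p r s → reflexive (+-assoc p r s)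
      }
    ; identityˡ = λ _ → ≈-refl
    ; comm      = λ p r → reflexive (+-comm p r)
    }
  }
  where open IsEquivalence ≈-isEquivalence using (reflexive) renaming (refl to ≈-refl)

private
  module + = CommutativeMonoid +-commutativeMonoid
open CommutativeSemigroupProperties +.commutativeSemigroup using (interchange; x∙yz≈y∙xz)

-- Laws of scalar multiplication.

·-congˡ : ∀ c {p r} → p ≈ r → c · p ≈ c · r
·-congˡ c {p} {r} e = coeffs λ i → begin
  coeff (c · p) i  ≡⟨ coeff-· c p i ⟩
  c ℤ.* coeff p i  ≡⟨ cong (c ℤ.*_) (coeff-≡ e i) ⟩
  c ℤ.* coeff r i  ≡⟨ coeff-· c r i ⟨
  coeff (c · r) i  ∎
  where open ≡-Reasoning

·-zeroˡ : ∀ p → 0ℤ · p ≈ []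
·-zeroˡ p = coeffs (coeff-· 0ℤ p)

·-identityˡ : ∀ p → 1ℤ · p ≈ p
·-identityˡ p = coeffs λ i → trans (coeff-· 1ℤ p i) (ℤ.*-identityˡ _)

·-assoc : ∀ c d p → (c ℤ.* d) · p ≡ c · d · p
·-assoc c d []      = refl
·-assoc c d (e ∷ p) = cong₂ _∷_ (ℤ.*-assoc c d e) (·-assoc c d p)

·-distribˡ : ∀ c p r → c · (p + r) ≡ c · p + c · r
·-distribˡ c []      r       = refl
·-distribˡ c (d ∷ p) []      = refl
·-distribˡ c (d ∷ p) (e ∷ r) = cong₂ _∷_ (ℤ.*-distribˡ-+ c d e) (·-distribˡ c p r)

·-distribʳ : ∀ p c d → (c ℤ.+ d) · p ≡ c · p + d · p
·-distribʳ []      c d = refl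
·-distribʳ (e ∷ p) c d = cong₂ _∷_ (ℤ.*-distribʳ-+ e c d) (·-distribʳ p c d)

·-shift : ∀ c p → c · (0ℤ ∷ p) ≈ 0ℤ ∷ c · p
·-shift c p = ∷-cong (ℤ.*-zeroʳ c) +.refl

-- Commutative semiring structure on polynomials.

*-zeroʳ : ∀ p → p * [] ≈ []
*-zeroʳ []      = +.refl
*-zeroʳ (c ∷ p) = +.trans (∷-cong refl (*-zeroʳ p)) 0∷[]≈[]

*-congˡ : ∀ p {r s} → r ≈ s → p * r ≈ p * s
*-congˡ []      e = +.refl
*-congˡ (c ∷ p) e = +-cong (·-congˡ c e) (∷-cong refl (*-congˡ p e))

-- Mirror image of the defining equation of `_*_`, which recurses on the left factor; this is the
-- inductive step of `*-comm`.
*-∷ : ∀ p d r → p * (d ∷ r) ≈ d · p + (0ℤ ∷ p * r)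
*-∷ []      d r = +.sym 0∷[]≈[]
-- Both sides reduce to a cons: the heads are `c d + 0` and `d c + 0`, and the chain compares the
-- tails.
*-∷ (c ∷ p) d r = ∷-cong (cong (ℤ._+ 0ℤ) (ℤ.*-comm c d)) (begin
  c · r + p * (d ∷ r)               ≈⟨ +.∙-congˡ (*-∷ p d r) ⟩
  c · r + (d · p + (0ℤ ∷ p * r))    ≈⟨ x∙yz≈y∙xz (c · r) (d · p) (0ℤ ∷ p * r) ⟩
  d · p + (c · r + (0ℤ ∷ p * r))    ∎)
  where open ≈-Reasoning +.setoid

*-comm : ∀ p r → p * r ≈ r * p
*-comm []      r = +.sym (*-zeroʳ r)
*-comm (c ∷ p) r = begin
  c · r + (0ℤ ∷ p * r)  ≈⟨ +.∙-congˡ (∷-cong refl (*-comm p r)) ⟩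
  c · r + (0ℤ ∷ r * p)  ≈⟨ *-∷ r c p ⟨
  r * (c ∷ p)           ∎
  where open ≈-Reasoning +.setoid

*-distribʳ-+ : ∀ s p r → (p + r) * s ≈ p * s + r * s
*-distribʳ-+ s []      r       = +.refl
*-distribʳ-+ s (c ∷ p) []      = +.sym (+.identityʳ _)
*-distribʳ-+ s (c ∷ p) (d ∷ r) = begin
  (c ℤ.+ d) · s + (0ℤ ∷ (p + r) * s)
    ≈⟨ +-cong (+.reflexive (·-distribʳ s c d)) (∷-cong refl (*-distribʳ-+ s p r)) ⟩
  (c · s + d · s) + ((0ℤ ∷ p * s) + (0ℤ ∷ r * s))
    ≈⟨ interchange (c · s) (d · s) (0ℤ ∷ p * s) (0ℤ ∷ r * s) ⟩
  (c · s + (0ℤ ∷ p * s)) + (d · s + (0ℤ ∷ r * s))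
    ∎
  where open ≈-Reasoning +.setoid

·-*-assoc : ∀ c p r → (c · p) * r ≈ c · (p * r)
·-*-assoc c []      r = +.refl
·-*-assoc c (d ∷ p) r = begin
  (c ℤ.* d) · r + (0ℤ ∷ (c · p) * r)
    ≈⟨ +-cong (+.reflexive (·-assoc c d r)) (∷-cong refl (·-*-assoc c p r)) ⟩
  c · d · r + (0ℤ ∷ c · (p * r))
    ≈⟨ +.∙-congˡ (·-shift c (p * r)) ⟨
  c · d · r + c · (0ℤ ∷ p * r)
    ≡⟨ ·-distribˡ c (d · r) (0ℤ ∷ p * r) ⟨
  c · (d · r + (0ℤ ∷ p * r))
    ∎
  where open ≈-Reasoning +.setoid

shift-* : ∀ p r → (0ℤ ∷ p) * r ≈ 0ℤ ∷ p * r
shift-* p r = +.∙-congʳ (·-zeroˡ r)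

-- Writing `c ∷ p` as `c + q p`, distributivity separates the two terms; `·-*-assoc` then moves `c`,
-- and `shift-*` the factor `q`, out of the product.
*-assoc : ∀ p r s → (p * r) * s ≈ p * (r * s)
*-assoc []      r s = +.refl
*-assoc (c ∷ p) r s = begin
  (c · r + (0ℤ ∷ p * r)) * s
    ≈⟨ *-distribʳ-+ s (c · r) (0ℤ ∷ p * r) ⟩
  (c · r) * s + (0ℤ ∷ p * r) * s
    ≈⟨ +-cong (·-*-assoc c r s) (shift-* (p * r) s) ⟩
  c · (r * s) + (0ℤ ∷ (p * r) * s)
    ≈⟨ +.∙-congˡ (∷-cong refl (*-assoc p r s)) ⟩
  c · (r * s) + (0ℤ ∷ p * (r * s))
    ∎
  where open ≈-Reasoning +.setoid

*-identityˡ : ∀ p → const 1 * p ≈ p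
*-identityˡ p = begin
  1ℤ · p + (0ℤ ∷ [])  ≈⟨ +-cong (·-identityˡ p) 0∷[]≈[] ⟩
  p + []              ≈⟨ +.identityʳ p ⟩
  p                   ∎
  where open ≈-Reasoning +.setoid

-- Equal left factors may be lists of different lengths, which suits the recursion of `_*_` badly;
-- commutativity carries them to the right, where `*-congˡ` applies.
*-cong : ∀ {p p′ r r′} → p ≈ p′ → r ≈ r′ → p * r ≈ p′ * r′
*-cong {p} {p′} {r} {r′} e f = begin
  p * r    ≈⟨ *-congˡ p f ⟩
  p * r′   ≈⟨ *-comm p r′ ⟩
  r′ * p   ≈⟨ *-congˡ r′ e ⟩
  r′ * p′  ≈⟨ *-comm r′ p′ ⟩
  p′ * r′  ∎
  where open ≈-Reasoning +.setoid

-- Has the same operations as the raw semiring `ℤ[q]`, so general laws of powers and sums apply to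
-- the `_^_` and `sum` of the statement.
ℤ[q]-commutativeSemiring : CommutativeSemiring 0ℓ 0ℓ
ℤ[q]-commutativeSemiring = record
  { _+_ = _+_
  ; _*_ = _*_
  ; 0#  = []
  ; 1#  = const 1
  ; isCommutativeSemiring = isCommutativeSemiringˡ record
    { +-isCommutativeMonoid = +.isCommutativeMonoid
    ; *-isCommutativeMonoid = isCommutativeMonoidˡ record
      { isSemigroup = record
        { isMagma = record { isEquivalence = ≈-isEquivalence ; ∙-cong = *-cong }
        ; assoc   = *-assoc
        }
      ; identityˡ = *-identityˡ
      ; comm      = *-comm
      }
    ; distribʳ = *-distribʳ-+
    ; zeroˡ    = λ _ → +.refl
    }
  }

private
  module R = CommutativeSemiring ℤ[q]-commutativeSemiring
open Exp R.semiring using (^-homo-*)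
open Sum R.semiring using (sum-cong-≋; sum-init-last; *-distribˡ-sum)
open CommutativeSemigroupProperties R.*-commutativeSemigroup
  using () renaming (x∙yz≈y∙xz to x*yz≈y*xz)

-- Finite sums.

Σ-cong : ∀ n {f g} → (∀ {k} → k ℕ.≤ n → f k ≈ g k) → Σ[k≤ n ] f ≈ Σ[k≤ n ] g
Σ-cong n e = sum-cong-≋ {suc n} λ i → e (toℕ≤pred[n] i)

*-distribˡ-Σ : ∀ n p f → p * Σ[k≤ n ] f ≈ Σ[k≤ n ] (λ k → p * f k)
*-distribˡ-Σ n p f = *-distribˡ-sum {suc n} p (λ i → f (toℕ i))

-- `sum` unfolds at its first term, whereas the induction on `n` adds a last one.
Σ-last : ∀ n f → Σ[k≤ suc n ] f ≈ Σ[k≤ n ] f + f (suc n)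
Σ-last n f = begin
  Σ[k≤ suc n ] f
    ≈⟨ sum-init-last {suc n} (λ i → f (toℕ i)) ⟩
  sum {suc n} (λ i → f (toℕ (inject₁ i))) + f (toℕ (fromℕ (suc n)))
    ≈⟨ +-cong (sum-cong-≋ {suc n} λ i → R.reflexive (cong f (toℕ-inject₁ i)))
              (R.reflexive (cong f (toℕ-fromℕ (suc n)))) ⟩
  Σ[k≤ n ] f + f (suc n)
    ∎
  where open ≈-Reasoning R.setoid

-- The recurrence at even indices and the exponents.

F-even : ∀ a b n → F a b (2 ℕ.* n ℕ.+ 2) ≡
  const a * F a b (2 ℕ.* n ℕ.+ 1) + q ^ (2 ℕ.* n) * F a b (2 ℕ.* n)
F-even a b n
  -- Moving the successors to the front lets `F` unfold; multiplicativity of parity makes `2 n`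
  -- even, which selects the coefficient `a`.
  rewrite ℕ.+-comm (2 ℕ.* n) 2 | ℕ.+-comm (2 ℕ.* n) 1 | ℙ.*-homo-* 2 n = refl

pronic-mono : ∀ {k n} → k ℕ.≤ n → k ℕ.^ 2 ℕ.+ k ℕ.≤ n ℕ.^ 2 ℕ.+ n
pronic-mono k≤n = ℕ.+-mono-≤ (ℕ.^-monoˡ-≤ 2 k≤n) k≤n

pronic-suc : ∀ n → suc n ℕ.^ 2 ℕ.+ suc n ≡ 2 ℕ.* suc n ℕ.+ (n ℕ.^ 2 ℕ.+ n)
pronic-suc = expanded
  where
  -- The reflective solver fails on literal exponents, hence the unfolded squares.
  expanded : ∀ n → suc n ℕ.* (suc n ℕ.* 1) ℕ.+ suc n ≡ 2 ℕ.* suc n ℕ.+ (n ℕ.* (n ℕ.* 1) ℕ.+ n)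
  expanded = ℕ-Solver.solve-∀

-- Keeps `n` as a parameter because the induction changes the exponent of every term.
summand : (a b n k : ℕ) → Poly
summand a b n k = F a b (2 ℕ.* k ℕ.+ 1) * q ^ ((n ℕ.^ 2 ℕ.+ n) ∸ (k ℕ.^ 2 ℕ.+ k))

summand-suc : ∀ a b n {k} → k ℕ.≤ n → summand a b (suc n) k ≈ q ^ (2 ℕ.* suc n) * summand a b n k
summand-suc a b n {k} k≤n = begin
  f * q ^ ((suc n ℕ.^ 2 ℕ.+ suc n) ∸ j)  ≡⟨ cong (λ e → f * q ^ e) exponent ⟩
  f * q ^ (2 ℕ.* suc n ℕ.+ d)            ≈⟨ *-congˡ f (^-homo-* q (2 ℕ.* suc n) d) ⟩
  f * (q ^ (2 ℕ.* suc n) * q ^ d)        ≈⟨ x*yz≈y*xz f (q ^ (2 ℕ.* suc n)) (q ^ d) ⟩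
  q ^ (2 ℕ.* suc n) * (f * q ^ d)        ∎
  where
  open ≈-Reasoning R.setoid
  f = F a b (2 ℕ.* k ℕ.+ 1)
  j = k ℕ.^ 2 ℕ.+ k
  d = (n ℕ.^ 2 ℕ.+ n) ∸ j
  exponent : (suc n ℕ.^ 2 ℕ.+ suc n) ∸ j ≡ 2 ℕ.* suc n ℕ.+ d
  -- Since `∸` truncates, taking `2 (n + 1)` out of the difference relies on `k² + k ≤ n² + n`.
  exponent = trans (cong (_∸ j) (pronic-suc n)) (ℕ.+-∸-assoc (2 ℕ.* suc n) (pronic-mono k≤n))

summand-diagonal : ∀ a b n → summand a b n n ≈ F a b (2 ℕ.* n ℕ.+ 1)
summand-diagonal a b n = begin
  f * q ^ (j ∸ j)  ≡⟨ cong (λ e → f * q ^ e) (ℕ.n∸n≡0 j) ⟩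
  f * const 1      ≈⟨ R.*-identityʳ f ⟩
  f                ∎
  where
  open ≈-Reasoning R.setoid
  f = F a b (2 ℕ.* n ℕ.+ 1)
  j = n ℕ.^ 2 ℕ.+ n

-- Recurrence of the sum and the induction.

Σ-summand-suc : ∀ a b n → Σ[k≤ suc n ] (summand a b (suc n)) ≈
  q ^ (2 ℕ.* suc n) * Σ[k≤ n ] (summand a b n) + F a b (2 ℕ.* suc n ℕ.+ 1)
Σ-summand-suc a b n = begin
  Σ[k≤ suc n ] (summand a b (suc n))
    ≈⟨ Σ-last n (summand a b (suc n)) ⟩
  Σ[k≤ n ] (summand a b (suc n)) + summand a b (suc n) (suc n)
    ≈⟨ +-cong (Σ-cong n (summand-suc a b n)) (summand-diagonal a b (suc n)) ⟩
  Σ[k≤ n ] (λ k → Q * summand a b n k) + F a b (2 ℕ.* suc n ℕ.+ 1)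
    ≈⟨ R.+-congʳ (*-distribˡ-Σ n Q (summand a b n)) ⟨
  Q * Σ[k≤ n ] (summand a b n) + F a b (2 ℕ.* suc n ℕ.+ 1)
    ∎
  where
  open ≈-Reasoning R.setoid
  Q = q ^ (2 ℕ.* suc n)

theorem14 : (a b : ℕ) .{{_ : NonZero a}} .{{_ : NonZero b}} (n : ℕ) →
    const a * Σ[k≤ n ] (λ k → F a b (2 ℕ.* k ℕ.+ 1) * q ^ ((n ℕ.^ 2 ℕ.+ n) ∸ (k ℕ.^ 2 ℕ.+ k)))
    ≈ F a b (2 ℕ.* n ℕ.+ 2)
theorem14 a b zero = begin
  const a * (summand a b 0 0 + [])         ≈⟨ *-congˡ (const a) (+.identityʳ (summand a b 0 0)) ⟩
  const a * summand a b 0 0                ≈⟨ *-congˡ (const a) (summand-diagonal a b 0) ⟩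
  const a * const 1                        ≈⟨ +.identityʳ (const a * const 1) ⟨
  -- The zero added here becomes `q ^ 0 * F a b 0`, completing the unfolded form of `F a b 2`.
  const a * const 1 + []                   ≈⟨ R.+-congˡ {const a * const 1} (*-zeroʳ (const 1)) ⟨
  const a * const 1 + const 1 * []         ∎
  where open ≈-Reasoning R.setoid
theorem14 a b (suc n) = begin
  A * Σ[k≤ suc n ] (summand a b (suc n))   ≈⟨ *-congˡ A (Σ-summand-suc a b n) ⟩
  A * (Q * S + f)                          ≈⟨ R.distribˡ A (Q * S) f ⟩
  A * (Q * S) + A * f                      ≈⟨ R.+-comm (A * (Q * S)) (A * f) ⟩
  -- Moving `A` past `Q` exposes `A * S`, the left-hand side of the induction hypothesis.
  A * f + A * (Q * S)                      ≈⟨ R.+-congˡ (x*yz≈y*xz A Q S) ⟩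
  A * f + Q * (A * S)                      ≈⟨ R.+-congˡ (*-congˡ Q (theorem14 a b n)) ⟩
  -- The two forms of the index are equal but not definitionally, and `F-even` expects the second.
  A * f + Q * F a b (2 ℕ.* n ℕ.+ 2)        ≡⟨ cong (λ m → A * f + Q * F a b m) 2n+2 ⟩
  A * f + Q * F a b (2 ℕ.* suc n)          ≡⟨ F-even a b (suc n) ⟨
  F a b (2 ℕ.* suc n ℕ.+ 2)                ∎
  where
  open ≈-Reasoning R.setoid
  A = const a
  Q = q ^ (2 ℕ.* suc n)
  S = Σ[k≤ n ] (summand a b n)
  f = F a b (2 ℕ.* suc n ℕ.+ 1)
  2n+2 : 2 ℕ.* n ℕ.+ 2 ≡ 2 ℕ.* suc n
  2n+2 = trans (ℕ.+-comm (2 ℕ.* n) 2) (sym (ℕ.*-suc 2 n))
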